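{- Let $\mathcal{L}$ be an algebraic signature with at least one constant symbol and let $\mathcal{V}$ be a variety of $\mathcal{L}$-algebras. Then $\mathcal{V}$ is coherent if and only if any (equivalently, each) of the following equivalent conditions holds: (1) For any finite disjoint sets of variables $\overline{x},\overline{y}$ and any finite set $\Sigma$ of equations with variables in $\overline{x},\overline{y}$, there exists a finite set $\Pi$ of equations with variables in $\overline{y}$ such that for every equation $\varepsilon$ with variables in $\overline{y}$, $\Sigma\models_{\mathcal{V}}\varepsilon \iff \Pi\models_{\mathcal{V}}\varepsilon$. (2) For any finite disjoint sets $\overline{x},\overline{y}$ and any compact congruence $\Theta$ on $\mathbf{F}(\overline{x},\overline{y})$, the congruence $\Theta\cap F(\overline{y})^2$ on $\mathbf{F}(\overline{y})$ is compact. (3) For any finite disjoint sets $\overline{x},\overline{y}$, the compact lifting of the inclusion map $\mathbf{F}(\overline{y})\to\mathbf{F}(\overline{x},\overline{y})$ has a right adjoint. (4) The compact lifting of any homomorphism between finitely presented algebras in $\mathcal{V}$ has a right adjoint.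
   Context: $\mathbf{F}(\overline{x})$ is the free algebra of $\mathcal{V}$ over the set $\overline{x}$, with universe $F(\overline{x})$; $\overline{x},\overline{y}$ denotes the union of disjoint sets $\overline{x}$ and $\overline{y}$, and $\mathbf{F}(\overline{y})$ is regarded as a subalgebra of $\mathbf{F}(\overline{x},\overline{y})$. For a set of equations $\Sigma\cup\{\varepsilon\}$, $\Sigma\models_{\mathcal{V}}\varepsilon$ means: for every $\mathbf{A}\in\mathcal{V}$ and every homomorphism $e$ from the term algebra (over the variables involved) to $\mathbf{A}$, if $e$ satisfies all equations in $\Sigma$ (i.e. $\Sigma\subseteq\ker e$), then $e$ satisfies $\varepsilon$. A congruence is compact if it is finitely generated; $\mathrm{KCon}\,\mathbf{A}$ is the poset (join-semilattice) of compact congruences of $\mathbf{A}$ ordered by inclusion. For a homomorphism $h\colon\mathbf{A}\to\mathbf{B}$, the compact lifting of $h$ is the map $\mathrm{KCon}\,\mathbf{A}\to\mathrm{KCon}\,\mathbf{B}$ sending $\psi$ to the congruence of $\mathbf{B}$ generated by $\{\langle h(a),h(a')\rangle\mid\langle a,a'\rangle\in\psi\}$. A right adjoint of an order-preserving map $u\colon P\to Q$ is an order-preserving map $v\colon Q\to P$ with $u(p)\le q\iff p\le v(q)$. An algebra in $\mathcal{V}$ is finitely presented if it is isomorphic to $\mathbf{F}(\overline{x})/\Theta$ for some finite $\overline{x}$ and compact $\Theta$. $\mathcal{V}$ is coherent if every finitely generated subalgebra of a finitely presented member of $\mathcal{V}$ is finitely presented. -}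

module Defs where

open import Data.Fin.Base using (Fin)
open import Data.List.Base using (List; map)
open import Data.List.Membership.Propositional using (_∈_)
open import Data.List.Membership.Propositional.Properties using (∈-map⁺; ∈-map⁻)
open import Data.List.Relation.Unary.All using (All)
open import Data.Nat.Base using (ℕ)
open import Data.Product.Base using (Σ; ∃; ∃-syntax; _×_; _,_; proj₁; proj₂; swap)
open import Data.Sum.Base using (_⊎_; inj₁; inj₂; [_,_]′)
open import Data.Vec.Functional using (Vector)
open import Data.Vec.Functional.Relation.Binary.Pointwise using (Pointwise)
open import Function.Base using (_∘_; _on_)
open import Function.Definitions using (Injective; Bijective)
open import Level using (Level; suc)
open import Relation.Binary.Bundles using (Setoid; Poset)
open import Relation.Binary.Core using (Rel; _⇒_)
  renaming (_⇔_ to _⇔ᵣ_)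
open import Relation.Binary.Definitions using (Adjoint)
open import Relation.Binary.Morphism.Bundles using (PosetHomomorphism; mkPosetHomo)
open import Relation.Binary.PropositionalEquality.Core as ≡ using (_≡_)
open import Relation.Binary.Structures using (IsEquivalence)
open import Relation.Unary using (Pred) renaming (_≐_ to _≐ₛ_)
import Relation.Binary.Construct.On as On

-- All signatures, algebras and relations live in one universe Set ℓ, so that
-- free algebras and quotients belong to the class of algebras quantified over.
-- Algebras are setoid based; the setoid equality plays the role of equality.

record Signature (ℓ : Level) : Set (suc ℓ) where
  field
    Op    : Set ℓ
    arity : Op → ℕ

  HasConstant : Set ℓ
  HasConstant = ∃[ c ] arity c ≡ 0

open Signature public using (HasConstant)

record Algebra {ℓ : Level} (𝓛 : Signature ℓ) : Set (suc ℓ) where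
  open Signature 𝓛
  infix 4 _≈_
  field
    Carrier       : Set ℓ
    _≈_           : Rel Carrier ℓ
    isEquivalence : IsEquivalence _≈_
    op            : (f : Op) → Vector Carrier (arity f) → Carrier
    op-cong       : (f : Op) {as bs : Vector Carrier (arity f)} →
                    Pointwise _≈_ as bs → op f as ≈ op f bs

  open IsEquivalence isEquivalence public using (refl; sym; trans)

open Algebra public using (Carrier)

record Hom {ℓ : Level} {𝓛 : Signature ℓ} (A B : Algebra 𝓛) : Set ℓ where
  open Signature 𝓛
  private
    module A = Algebra A
    module B = Algebra B
  field
    ⟦_⟧  : A.Carrier → B.Carrier
    cong : ∀ {a a′} → a A.≈ a′ → ⟦ a ⟧ B.≈ ⟦ a′ ⟧
    homo : (f : Op) (as : Vector A.Carrier (arity f)) →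
           ⟦ A.op f as ⟧ B.≈ B.op f (⟦_⟧ ∘ as)

open Hom public using (⟦_⟧)

IsIsomorphism : {ℓ : Level} {𝓛 : Signature ℓ} {A B : Algebra 𝓛} → Hom A B → Set ℓ
IsIsomorphism {A = A} {B} h = Bijective (Algebra._≈_ A) (Algebra._≈_ B) ⟦ h ⟧

infix 4 _≅_

_≅_ : {ℓ : Level} {𝓛 : Signature ℓ} → Algebra 𝓛 → Algebra 𝓛 → Set ℓ
A ≅ B = Σ (Hom A B) IsIsomorphism

module _ {ℓ : Level} (𝓛 : Signature ℓ) where
  open Signature 𝓛

  data Term (X : Set) : Set ℓ where
    var : X → Term X
    app : (f : Op) → Vector (Term X) (arity f) → Term X

  Equation : Set → Set ℓ
  Equation X = Term X × Term X

  -- Syntactic identity of terms.  Argument tuples are functions, for which _≡_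
  -- would be too fine without function extensionality.
  data Identical {X : Set} : Rel (Term X) ℓ where
    var-cong : ∀ {x y} → x ≡ y → Identical (var x) (var y)
    app-cong : (f : Op) {ss ts : Vector (Term X) (arity f)} →
               Pointwise Identical ss ts → Identical (app f ss) (app f ts)

  TermAlgebra : Set → Algebra 𝓛
  TermAlgebra X = record
    { Carrier       = Term X
    ; _≈_           = Identical
    ; isEquivalence = record { refl = refl ; sym = sym ; trans = trans }
    ; op            = app
    ; op-cong       = app-cong
    }
    where
    refl : {t : Term X} → Identical t t
    refl {var x}    = var-cong ≡.refl
    refl {app f ts} = app-cong f (λ i → refl {ts i})

    sym : {s t : Term X} → Identical s t → Identical t s
    sym (var-cong p)    = var-cong (≡.sym p)
    sym (app-cong f ps) = app-cong f (λ i → sym (ps i))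

    trans : {s t u : Term X} → Identical s t → Identical t u → Identical s u
    trans (var-cong p)    (var-cong q)     = var-cong (≡.trans p q)
    trans (app-cong f ps) (app-cong .f qs) = app-cong f (λ i → trans (ps i) (qs i))

module _ {ℓ : Level} {𝓛 : Signature ℓ} where

  eval : (A : Algebra 𝓛) {X : Set} → (X → Carrier A) → Term 𝓛 X → Carrier A
  eval A ρ (var x)    = ρ x
  eval A ρ (app f ts) = Algebra.op A f (λ i → eval A ρ (ts i))

  evalHom : (A : Algebra 𝓛) {X : Set} → (X → Carrier A) → Hom (TermAlgebra 𝓛 X) A
  evalHom A {X} ρ = record
    { ⟦_⟧  = eval A ρ
    ; cong = eval-cong
    ; homo = λ f ts → A.refl
    }
    where
    module A = Algebra A
    eval-cong : {s t : Term 𝓛 X} → Identical 𝓛 s t → eval A ρ s A.≈ eval A ρ t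
    eval-cong (var-cong ≡.refl) = A.refl
    eval-cong (app-cong f ps)   = A.op-cong f (λ i → eval-cong (ps i))

  rename : {X Y : Set} → (X → Y) → Term 𝓛 X → Term 𝓛 Y
  rename {Y = Y} ρ = eval (TermAlgebra 𝓛 Y) (var ∘ ρ)

  renameEq : {X Y : Set} → (X → Y) → Equation 𝓛 X → Equation 𝓛 Y
  renameEq ρ (s , t) = rename ρ s , rename ρ t

  infix 4 _⊩_

  _⊩_ : {A : Algebra 𝓛} {X : Set} → Hom (TermAlgebra 𝓛 X) A → Equation 𝓛 X → Set ℓ
  _⊩_ {A} e (s , t) = Algebra._≈_ A (⟦ e ⟧ s) (⟦ e ⟧ t)

-- A variety is an equational class, given by a possibly infinite set of axioms
-- in countably many variables.  (The closure of a class under H, S and P would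
-- only yield free algebras impredicatively, as products over all its members.)

Variety : {ℓ : Level} → Signature ℓ → Set (suc ℓ)
Variety {ℓ} 𝓛 = Pred (Equation 𝓛 ℕ) ℓ

infix 4 _∈ᵥ_ _⊨[_]_

_∈ᵥ_ : {ℓ : Level} {𝓛 : Signature ℓ} → Algebra 𝓛 → Variety 𝓛 → Set ℓ
_∈ᵥ_ {𝓛 = 𝓛} A V = (e : Hom (TermAlgebra 𝓛 ℕ) A) {ε : Equation 𝓛 ℕ} → V ε → e ⊩ ε

_⊨[_]_ : {ℓ : Level} {𝓛 : Signature ℓ} {X : Set} →
         List (Equation 𝓛 X) → Variety 𝓛 → Equation 𝓛 X → Set (suc ℓ)
_⊨[_]_ {𝓛 = 𝓛} {X} Γ V ε =
  (A : Algebra 𝓛) → A ∈ᵥ V → (e : Hom (TermAlgebra 𝓛 X) A) → All (e ⊩_) Γ → e ⊩ ε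

record Congruence {ℓ : Level} {𝓛 : Signature ℓ} (A : Algebra 𝓛) : Set (suc ℓ) where
  open Signature 𝓛
  private module A = Algebra A
  infix 4 _∼_
  field
    _∼_           : Rel A.Carrier ℓ
    isEquivalence : IsEquivalence _∼_
    respects-≈    : A._≈_ ⇒ _∼_
    compatible    : (f : Op) {as bs : Vector A.Carrier (arity f)} →
                    Pointwise _∼_ as bs → A.op f as ∼ A.op f bs

infix 4 _⊆ᶜ_

_⊆ᶜ_ : {ℓ : Level} {𝓛 : Signature ℓ} {A : Algebra 𝓛} → Rel (Congruence A) ℓ
Φ ⊆ᶜ Ψ = Congruence._∼_ Φ ⇒ Congruence._∼_ Ψ

module _ {ℓ : Level} {𝓛 : Signature ℓ} (A : Algebra 𝓛) where
  open Signature 𝓛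
  open Algebra A hiding (Carrier; refl; sym; trans)

  data Generated (R : Rel (Carrier A) ℓ) : Rel (Carrier A) ℓ where
    gen   : R ⇒ Generated R
    equal : _≈_ ⇒ Generated R
    symm  : ∀ {a b} → Generated R a b → Generated R b a
    tran  : ∀ {a b c} → Generated R a b → Generated R b c → Generated R a c
    comp  : (f : Op) {as bs : Vector (Carrier A) (arity f)} →
            Pointwise (Generated R) as bs → Generated R (op f as) (op f bs)

  Cg : Rel (Carrier A) ℓ → Congruence A
  Cg R = record
    { _∼_           = Generated R
    ; isEquivalence = record
      { refl = equal (Algebra.refl A) ; sym = symm ; trans = tran }
    ; respects-≈    = equal
    ; compatible    = comp
    }

  Cg-least : {R : Rel (Carrier A) ℓ} (Θ : Congruence A) →
             R ⇒ Congruence._∼_ Θ → Cg R ⊆ᶜ Θ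
  Cg-least {R} Θ R⊆Θ = go
    where
    module Θ = Congruence Θ
    module E = IsEquivalence Θ.isEquivalence
    go : Generated R ⇒ Θ._∼_
    go (gen r)     = R⊆Θ r
    go (equal p)   = Θ.respects-≈ p
    go (symm p)    = E.sym (go p)
    go (tran p q)  = E.trans (go p) (go q)
    go (comp f ps) = Θ.compatible f (λ i → go (ps i))

  Pairs : List (Carrier A × Carrier A) → Rel (Carrier A) ℓ
  Pairs ps a b = (a , b) ∈ ps

  IsCompact : Congruence A → Set ℓ
  IsCompact Θ = ∃[ ps ] Congruence._∼_ Θ ⇔ᵣ Generated (Pairs ps)

  _/_ : Congruence A → Algebra 𝓛
  _/_ Θ = record
    { Carrier       = Carrier A
    ; _≈_           = Congruence._∼_ Θ
    ; isEquivalence = Congruence.isEquivalence Θ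
    ; op            = op
    ; op-cong       = Congruence.compatible Θ
    }

  KCon : Poset (suc ℓ) ℓ ℓ
  KCon = record
    { Carrier        = Σ (Congruence A) IsCompact
    ; _≈_            = λ (Φ , _) (Ψ , _) → Congruence._∼_ Φ ⇔ᵣ Congruence._∼_ Ψ
    ; _≤_            = λ (Φ , _) (Ψ , _) → Φ ⊆ᶜ Ψ
    ; isPartialOrder = record
      { isPreorder = record
        { isEquivalence = record
          { refl  = (λ p → p) , (λ p → p)
          ; sym   = swap
          ; trans = λ (f , f′) (g , g′) → (λ p → g (f p)) , (λ p → f′ (g′ p))
          }
        ; reflexive = proj₁
        ; trans     = λ f g p → g (f p)
        }
      ; antisym = λ f g → f , g
      }
    }

module _ {ℓ : Level} {𝓛 : Signature ℓ} {A B : Algebra 𝓛} (h : Hom A B) where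
  private
    module A = Algebra A
    module B = Algebra B

  preimage : Congruence B → Congruence A
  preimage Θ = record
    { _∼_           = Θ._∼_ on ⟦ h ⟧
    ; isEquivalence = On.isEquivalence ⟦ h ⟧ Θ.isEquivalence
    ; respects-≈    = λ p → Θ.respects-≈ (Hom.cong h p)
    ; compatible    = λ f ps →
        E.trans (Θ.respects-≈ (Hom.homo h f _))
          (E.trans (Θ.compatible f ps) (Θ.respects-≈ (B.sym (Hom.homo h f _))))
    }
    where
    module Θ = Congruence Θ
    module E = IsEquivalence Θ.isEquivalence

  data Image (R : Rel A.Carrier ℓ) : Rel B.Carrier ℓ where
    image : ∀ {a a′} → R a a′ → Image R (⟦ h ⟧ a) (⟦ h ⟧ a′)

  lifting : Congruence A → Congruence B
  lifting Ψ = Cg B (Image (Congruence._∼_ Ψ))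

  lifting-compact : {Ψ : Congruence A} → IsCompact A Ψ → IsCompact B (lifting Ψ)
  lifting-compact {Ψ} (ps , Ψ⊆ps , ps⊆Ψ) =
    map h² ps , Cg-least B (Cg B (Pairs B (map h² ps))) to , Cg-least B (lifting Ψ) from
    where
    h² : A.Carrier × A.Carrier → B.Carrier × B.Carrier
    h² (a , a′) = ⟦ h ⟧ a , ⟦ h ⟧ a′

    to : Image (Congruence._∼_ Ψ) ⇒ Generated B (Pairs B (map h² ps))
    to (image p) =
      Cg-least A (preimage (Cg B (Pairs B (map h² ps)))) (λ q → gen (∈-map⁺ h² q)) (Ψ⊆ps p)

    from : Pairs B (map h² ps) ⇒ Generated B (Image (Congruence._∼_ Ψ))
    from q with ∈-map⁻ h² q
    ... | (a , a′) , p , ≡.refl = gen (image (ps⊆Ψ (gen p)))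

  compactLifting : PosetHomomorphism (KCon A) (KCon B)
  compactLifting = mkPosetHomo (KCon A) (KCon B)
    (λ (Ψ , c) → lifting Ψ , lifting-compact {Ψ} c)
    (λ {(Φ , _)} {(Ψ , _)} Φ⊆Ψ →
      Cg-least B (lifting Ψ) (λ { (image p) → gen (image (Φ⊆Ψ p)) }))

HasRightAdjoint : {a b c d e f : Level} {P : Poset a b c} {Q : Poset d e f} →
                  PosetHomomorphism P Q → Set _
HasRightAdjoint {P = P} {Q} u =
  Σ (PosetHomomorphism Q P) λ v →
    Adjoint (Poset._≤_ P) (Poset._≤_ Q)
      (PosetHomomorphism.⟦_⟧ u) (PosetHomomorphism.⟦_⟧ v)

-- The free algebra F V X is the term algebra modulo all substitution instances
-- of the axioms; F∈V, extend and extend-unique establish its universal property.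

module _ {ℓ : Level} {𝓛 : Signature ℓ} where

  data Instance (V : Variety 𝓛) {X : Set} : Rel (Term 𝓛 X) ℓ where
    inst : {s t : Term 𝓛 ℕ} → V (s , t) →
           (σ : Hom (TermAlgebra 𝓛 ℕ) (TermAlgebra 𝓛 X)) →
           Instance V (⟦ σ ⟧ s) (⟦ σ ⟧ t)

  F : Variety 𝓛 → Set → Algebra 𝓛
  F V X = TermAlgebra 𝓛 X / Cg (TermAlgebra 𝓛 X) (Instance V)

  Hom-unique : {X : Set} {A : Algebra 𝓛} (let open Algebra A) (g h : Hom (TermAlgebra 𝓛 X) A) →
               (∀ x → ⟦ g ⟧ (var x) ≈ ⟦ h ⟧ (var x)) → ∀ t → ⟦ g ⟧ t ≈ ⟦ h ⟧ t
  Hom-unique         g h p (var x)    = p x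
  Hom-unique {A = A} g h p (app f ts) =
    A.trans (Hom.homo g f ts)
      (A.trans (A.op-cong f (λ i → Hom-unique g h p (ts i)))
        (A.sym (Hom.homo h f ts)))
    where module A = Algebra A

  F∈V : (V : Variety 𝓛) (X : Set) → F V X ∈ᵥ V
  F∈V V X e {s , t} ax =
    Fr.trans (agree s) (Fr.trans (gen (inst ax σ)) (Fr.sym (agree t)))
    where
    module Fr = Algebra (F V X)
    σ : Hom (TermAlgebra 𝓛 ℕ) (TermAlgebra 𝓛 X)
    σ = evalHom (TermAlgebra 𝓛 X) (⟦ e ⟧ ∘ var)

    σ′ : Hom (TermAlgebra 𝓛 ℕ) (F V X)
    σ′ = record
      { ⟦_⟧ = ⟦ σ ⟧ ; cong = λ p → equal (Hom.cong σ p) ; homo = λ f ts → Fr.refl }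

    agree : ∀ u → ⟦ e ⟧ u Fr.≈ ⟦ σ ⟧ u
    agree = Hom-unique e σ′ (λ _ → Fr.refl)

  extend : {V : Variety 𝓛} {X : Set} {A : Algebra 𝓛} → A ∈ᵥ V →
           (X → Carrier A) → Hom (F V X) A
  extend {V} {X} {A} A∈V ρ = record
    { ⟦_⟧  = eval A ρ
    ; cong = Cg-least (TermAlgebra 𝓛 X) kernel sound
    ; homo = λ f ts → A.refl
    }
    where
    module A = Algebra A
    kernel : Congruence (TermAlgebra 𝓛 X)
    kernel = record
      { _∼_           = A._≈_ on eval A ρ
      ; isEquivalence = On.isEquivalence (eval A ρ) A.isEquivalence
      ; respects-≈    = Hom.cong (evalHom A ρ)
      ; compatible    = λ f ps → A.op-cong f ps
      }

    sound : Instance V ⇒ Congruence._∼_ kernel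
    sound (inst ax σ) = A∈V
      (record
        { ⟦_⟧  = eval A ρ ∘ ⟦ σ ⟧
        ; cong = λ p → Hom.cong (evalHom A ρ) (Hom.cong σ p)
        ; homo = λ f ts → Hom.cong (evalHom A ρ) (Hom.homo σ f ts)
        })
      ax

  extend-unique : {V : Variety 𝓛} {X : Set} {A : Algebra 𝓛} (let open Algebra A) →
                  (g h : Hom (F V X) A) →
                  (∀ x → ⟦ g ⟧ (var x) ≈ ⟦ h ⟧ (var x)) → ∀ t → ⟦ g ⟧ t ≈ ⟦ h ⟧ t
  extend-unique {V} {X} {A} g h = Hom-unique (restrict g) (restrict h)
    where
    restrict : Hom (F V X) A → Hom (TermAlgebra 𝓛 X) A
    restrict k = record
      { ⟦_⟧ = ⟦ k ⟧ ; cong = λ p → Hom.cong k (equal p) ; homo = Hom.homo k }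

  inclusion : (V : Variety 𝓛) (X Y : Set) → Hom (F V Y) (F V (X ⊎ Y))
  inclusion V X Y = extend (F∈V V (X ⊎ Y)) (var ∘ inj₂)

  -- A constant provides a value for the discarded variables, hence a retraction.
  inclusion-injective : HasConstant 𝓛 → (V : Variety 𝓛) (X Y : Set) →
    Injective (Algebra._≈_ (F V Y)) (Algebra._≈_ (F V (X ⊎ Y))) ⟦ inclusion V X Y ⟧
  inclusion-injective (c , c≡0) V X Y {s} {t} p =
    Fr.trans (Fr.sym (retract s)) (Fr.trans (Hom.cong r p) (retract t))
    where
    module Fr = Algebra (F V Y)
    const : Term 𝓛 Y
    const = app c (λ i → noFin (≡.subst Fin c≡0 i))
      where
      noFin : Fin 0 → Term 𝓛 Y
      noFin ()

    r : Hom (F V (X ⊎ Y)) (F V Y)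
    r = extend (F∈V V Y) [ (λ _ → const) , var ]′

    retract : ∀ u → ⟦ r ⟧ (⟦ inclusion V X Y ⟧ u) Fr.≈ u
    retract (var y)    = Fr.refl
    retract (app f ts) = Fr.op-cong f (λ i → retract (ts i))

  -- Θ ∩ F(Y)², with F(Y) identified with its image in F(X ⊎ Y).
  _∩F² : {V : Variety 𝓛} {X Y : Set} → Congruence (F V (X ⊎ Y)) → Congruence (F V Y)
  _∩F² {V} {X} {Y} Θ = preimage (inclusion V X Y) Θ

module _ {ℓ : Level} {𝓛 : Signature ℓ} where
  open Signature 𝓛

  record Subuniverse (A : Algebra 𝓛) : Set (suc ℓ) where
    private module A = Algebra A
    field
      Member : Pred A.Carrier ℓ
      resp   : ∀ {a b} → a A.≈ b → Member a → Member b
      closed : (f : Op) {as : Vector A.Carrier (arity f)} →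
               (∀ i → Member (as i)) → Member (A.op f as)

  subalgebra : (A : Algebra 𝓛) → Subuniverse A → Algebra 𝓛
  subalgebra A U = record
    { Carrier       = Σ A.Carrier U.Member
    ; _≈_           = A._≈_ on proj₁
    ; isEquivalence = On.isEquivalence proj₁ A.isEquivalence
    ; op            = λ f as → A.op f (proj₁ ∘ as) , U.closed f (proj₂ ∘ as)
    ; op-cong       = λ f ps → A.op-cong f ps
    }
    where
    module A = Algebra A
    module U = Subuniverse U

  data Sg (A : Algebra 𝓛) (S : Pred (Carrier A) ℓ) : Pred (Carrier A) ℓ where
    generator : ∀ {a} → S a → Sg A S a
    respects  : ∀ {a b} → Algebra._≈_ A a b → Sg A S a → Sg A S b
    apply     : (f : Op) {as : Vector (Carrier A) (arity f)} →
                (∀ i → Sg A S (as i)) → Sg A S (Algebra.op A f as)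

  IsFinitelyGenerated : {A : Algebra 𝓛} → Subuniverse A → Set ℓ
  IsFinitelyGenerated {A} U = ∃[ gs ] Subuniverse.Member U ≐ₛ Sg A (_∈ gs)

  FinitelyPresented : Variety 𝓛 → Algebra 𝓛 → Set (suc ℓ)
  FinitelyPresented V A =
    ∃[ n ] Σ (Congruence (F V (Fin n))) λ Θ →
      IsCompact (F V (Fin n)) Θ × A ≅ F V (Fin n) / Θ

  Coherent : Variety 𝓛 → Set (suc ℓ)
  Coherent V =
    (A : Algebra 𝓛) → A ∈ᵥ V → FinitelyPresented V A →
    (U : Subuniverse A) → IsFinitelyGenerated U →
    FinitelyPresented V (subalgebra A U)

{-# OPTIONS --safe #-}

-- Write h⁻¹Θ for the preimage of a congruence Θ under a homomorphism h.  Since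
-- the lifting of Ψ along h lies below Θ iff Ψ lies below h⁻¹Θ, the compact
-- lifting of h has a right adjoint iff h⁻¹ preserves compactness; so (3) is (2),
-- and (1) is (2) by completeness of equational logic.  Under (2), h⁻¹ preserves
-- compactness for every h between finitely presented algebras: h lifts to
-- k : F(y) → F(x), and k⁻¹Θ is the restriction to F(y) of the congruence on
-- F(x,y) generated by Θ and the pairs (y , k y).  Applied to the kernel of
-- F(y) → A this gives coherence.  Conversely, the subalgebra of F(x,y)/Θ
-- generated by y is F(y) modulo Θ ∩ F(y)², and the kernel of a map from a
-- finitely generated free algebra onto a finitely presented algebra is compact.

module Submission where

open import Defs
open import Level using (Level)
open import Data.Nat.Base using (ℕ; _+_)
open import Data.Fin.Base using (Fin; splitAt; join)
open import Data.Fin.Properties using (splitAt-join)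
open import Data.List.Base using (List; []; _∷_; map; _++_; lookup; length; allFin)
open import Data.List.Membership.Propositional using (_∈_)
open import Data.List.Membership.Propositional.Properties
  using (∈-map⁺; ∈-map⁻; ∈-++⁺ˡ; ∈-++⁺ʳ; ∈-++⁻; ∈-allFin; ∈-lookup)
open import Data.List.Relation.Unary.All as All using ()
open import Data.List.Relation.Unary.Any using (here; index)
open import Data.List.Relation.Unary.Any.Properties using (lookup-index)
open import Data.Product.Base using (Σ; ∃-syntax; _×_; _,_; proj₁; proj₂)
open import Data.Sum.Base using (_⊎_; inj₁; inj₂; [_,_]′)
open import Function.Base using (_∘_; id)
open import Function.Bundles using (_⇔_; mk⇔; Equivalence)
open import Function.Construct.Composition using () renaming (equivalence to infixr 8 _⨾_)
open import Function.Construct.Symmetry using (⇔-sym)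
open import Function.Definitions using (StrictlySurjective)
open import Relation.Binary.Construct.Union using (_∪_)
open import Relation.Binary.Core using (_⇒_) renaming (_⇔_ to _⇔ᵣ_)
open import Relation.Binary.Morphism.Bundles using (PosetHomomorphism; mkPosetHomo)
open import Relation.Binary.PropositionalEquality.Core as ≡ using (_≡_)
open import Relation.Binary.Structures using (IsEquivalence)
open import Relation.Unary using (Pred)

private
  variable
    ℓ : Level
    𝓛 : Signature ℓ
    A B C : Algebra 𝓛
    V : Variety 𝓛
    X : Set

-- Homomorphisms, isomorphisms and closure of the variety under quotients.

idHom : Hom A A
idHom {A = A} = record
  { ⟦_⟧ = id ; cong = id ; homo = λ f as → Algebra.refl A }

infixr 9 _∘ₕ_

_∘ₕ_ : Hom B C → Hom A B → Hom A C
_∘ₕ_ {C = C} g h = record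
  { ⟦_⟧  = ⟦ g ⟧ ∘ ⟦ h ⟧
  ; cong = Hom.cong g ∘ Hom.cong h
  ; homo = λ f as → Algebra.trans C (Hom.cong g (Hom.homo h f as)) (Hom.homo g f _)
  }

quotientMap : (Θ : Congruence A) → Hom A (A / Θ)
quotientMap Θ = record
  { ⟦_⟧  = id
  ; cong = Congruence.respects-≈ Θ
  ; homo = λ f as → IsEquivalence.refl (Congruence.isEquivalence Θ)
  }

IsSurjective : Hom A B → Set _
IsSurjective {B = B} h = StrictlySurjective (Algebra._≈_ B) ⟦ h ⟧

module _ {A B : Algebra 𝓛} (h : Hom A B) (iso : IsIsomorphism h) where
  private
    module A = Algebra A
    module B = Algebra B

    h⁻¹ : B.Carrier → A.Carrier
    h⁻¹ b = proj₁ (proj₂ iso b)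

    h∘h⁻¹ : ∀ b → ⟦ h ⟧ (h⁻¹ b) B.≈ b
    h∘h⁻¹ b = proj₂ (proj₂ iso b) A.refl

    h⁻¹-unique : ∀ {a b} → ⟦ h ⟧ a B.≈ b → h⁻¹ b A.≈ a
    h⁻¹-unique p = proj₁ iso (B.trans (h∘h⁻¹ _) (B.sym p))

  inverse : Hom B A
  inverse = record
    { ⟦_⟧  = h⁻¹
    ; cong = λ p → h⁻¹-unique (B.trans (h∘h⁻¹ _) (B.sym p))
    ; homo = λ f bs → h⁻¹-unique
        (B.trans (Hom.homo h f _) (B.op-cong f (λ i → h∘h⁻¹ (bs i))))
    }

  inverse-injective : ∀ {b b′} → h⁻¹ b A.≈ h⁻¹ b′ → b B.≈ b′
  inverse-injective p = B.trans (B.sym (h∘h⁻¹ _)) (B.trans (Hom.cong h p) (h∘h⁻¹ _))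

  inverse-surjective : IsSurjective inverse
  inverse-surjective a = ⟦ h ⟧ a , h⁻¹-unique B.refl

  ≅-inverse : B ≅ A
  ≅-inverse = inverse , inverse-injective ,
    λ a → ⟦ h ⟧ a , λ p → A.trans (Hom.cong inverse p) (proj₂ (inverse-surjective a))

-- An assignment in `B` lifts along `q` one variable at a time; the axiom holds at the lifted
-- assignment and `q` carries it back.
∈ᵥ-surjective : (q : Hom A B) → IsSurjective q → A ∈ᵥ V → B ∈ᵥ V
∈ᵥ-surjective {A = A} {B = B} q surj A∈V e {s , t} ax =
  B.trans (B.sym (agree s)) (B.trans (Hom.cong q (A∈V e′ ax)) (agree t))
  where
  module B = Algebra B
  e′ = evalHom A (λ x → proj₁ (surj (⟦ e ⟧ (var x))))

  agree : ∀ u → ⟦ q ⟧ (⟦ e′ ⟧ u) B.≈ ⟦ e ⟧ u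
  agree = Hom-unique (q ∘ₕ e′) e (λ x → proj₂ (surj (⟦ e ⟧ (var x))))

F/∈V : (Θ : Congruence (F V X)) → (F V X / Θ) ∈ᵥ V
F/∈V {V = V} {X = X} Θ =
  ∈ᵥ-surjective {V = V} (quotientMap Θ) (λ t → t , Algebra.refl (F V X / Θ)) (F∈V V X)

-- Compact congruences

identity : (A : Algebra 𝓛) → Congruence A
identity A = record
  { _∼_           = Algebra._≈_ A
  ; isEquivalence = Algebra.isEquivalence A
  ; respects-≈    = id
  ; compatible    = Algebra.op-cong A
  }

identity-compact : (A : Algebra 𝓛) → IsCompact A (identity A)
identity-compact A = [] , equal , Cg-least A (identity A) (λ ())

ker : Hom A B → Congruence A
ker {B = B} h = preimage h (identity B)

Cg-compact : (ps : List (Carrier A × Carrier A)) → IsCompact A (Cg A (Pairs A ps))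
Cg-compact ps = ps , id , id

compact-resp : (Φ Ψ : Congruence A) → Congruence._∼_ Φ ⇔ᵣ Congruence._∼_ Ψ →
               IsCompact A Φ → IsCompact A Ψ
compact-resp Φ Ψ (Φ⊆Ψ , Ψ⊆Φ) (ps , Φ⊆ps , ps⊆Φ) =
  ps , (λ p → Φ⊆ps (Ψ⊆Φ p)) , (λ p → Φ⊆Ψ (ps⊆Φ p))

-- The join of `Φ` with the congruence generated by `qs`.
adjoin : Congruence A → List (Carrier A × Carrier A) → Congruence A
adjoin {A = A} Φ qs = Cg A (Congruence._∼_ Φ ∪ Pairs A qs)

adjoin-compact : (Φ : Congruence A) (qs : List (Carrier A × Carrier A)) →
                 IsCompact A Φ → IsCompact A (adjoin Φ qs)
adjoin-compact {A = A} Φ qs (ps , Φ⊆ps , ps⊆Φ) =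
  ps ++ qs , Cg-least A (Cg A (Pairs A (ps ++ qs))) to , Cg-least A (adjoin Φ qs) from
  where
  to : Congruence._∼_ Φ ∪ Pairs A qs ⇒ Generated A (Pairs A (ps ++ qs))
  to (inj₁ p) = Cg-least A (Cg A (Pairs A (ps ++ qs))) (λ r → gen (∈-++⁺ˡ r)) (Φ⊆ps p)
  to (inj₂ q) = gen (∈-++⁺ʳ ps q)

  from : Pairs A (ps ++ qs) ⇒ Generated A (Congruence._∼_ Φ ∪ Pairs A qs)
  from r with ∈-++⁻ ps r
  ... | inj₁ p = gen (inj₁ (ps⊆Φ (gen p)))
  ... | inj₂ q = gen (inj₂ q)

lifting-least : (h : Hom A B) (Ψ : Congruence A) (Θ : Congruence B) →
                Ψ ⊆ᶜ preimage h Θ → lifting h Ψ ⊆ᶜ Θ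
lifting-least {B = B} h Ψ Θ Ψ⊆ = Cg-least B Θ (λ { (image p) → Ψ⊆ p })

-- Preimages of compact congruences.

PreimageCompact : {A B : Algebra 𝓛} → Hom A B → Set _
PreimageCompact {A = A} {B = B} h =
  (Θ : Congruence B) → IsCompact B Θ → IsCompact A (preimage h Θ)

-- A right adjoint can only be h⁻¹: principal congruences are compact, so testing the adjunction on
-- them determines its value pair by pair.
rightAdjoint⇔preimageCompact : (h : Hom A B) →
  HasRightAdjoint (compactLifting h) ⇔ PreimageCompact h
rightAdjoint⇔preimageCompact {A = A} {B = B} h = mk⇔ to from
  where
  to : HasRightAdjoint (compactLifting h) → PreimageCompact h
  to (v , adj) Θ Θ-compact = compact-resp (proj₁ vΘ) (preimage h Θ) (below , above) (proj₂ vΘ)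
    where
    vΘ : Σ (Congruence A) (IsCompact A)
    vΘ = PosetHomomorphism.⟦_⟧ v (Θ , Θ-compact)

    below : proj₁ vΘ ⊆ᶜ preimage h Θ
    -- The counit: the lifting of `vΘ` lies below `Θ`.
    below p = proj₂ (adj {vΘ} {Θ , Θ-compact}) id (gen (image p))

    above : preimage h Θ ⊆ᶜ proj₁ vΘ
    above {a} {a′} p = proj₁ (adj {principal , Cg-compact pair} {Θ , Θ-compact})
      (lifting-least h principal Θ (Cg-least A (preimage h Θ) (λ { (here ≡.refl) → p })))
      (gen (here ≡.refl))
      where
      pair = (a , a′) ∷ []
      principal = Cg A (Pairs A pair)

  from : PreimageCompact h → HasRightAdjoint (compactLifting h)
  from pc =
    mkPosetHomo (KCon B) (KCon A)
      (λ (Θ , c) → preimage h Θ , pc Θ c) (λ Φ⊆Ψ p → Φ⊆Ψ p) ,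
    λ { {Ψ , _} {Θ , _} →
        (λ le p → le (gen (image p))) , lifting-least h Ψ Θ }

module _ {A B : Algebra 𝓛} (q : Hom A B) (surj : IsSurjective q) where
  private
    module B = Algebra B

    lift : B.Carrier → Carrier A
    lift b = proj₁ (surj b)

    q∘lift : ∀ b → ⟦ q ⟧ (lift b) B.≈ b
    q∘lift b = proj₂ (surj b)

  module _ (Φ : Congruence B) where
    private
      module Φ = Congruence Φ
      module E = IsEquivalence Φ.isEquivalence

      q∘lift∼ : ∀ {b} → ⟦ q ⟧ (lift b) Φ.∼ b
      q∘lift∼ = Φ.respects-≈ (q∘lift _)

    -- By surjectivity `Φ` is the lifting of its own preimage, and liftings preserve compactness.
    preimage-compact⇒compact : IsCompact A (preimage q Φ) → IsCompact B Φ
    preimage-compact⇒compact c = compact-resp (lifting q (preimage q Φ)) Φ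
      ( lifting-least q (preimage q Φ) Φ id
      , λ p → tran (equal (B.sym (q∘lift _)))
               (tran (gen (image (E.trans q∘lift∼ (E.trans p (E.sym q∘lift∼)))))
                 (equal (q∘lift _))))
      (lifting-compact q {preimage q Φ} c)

    -- The preimage is generated by the kernel together with one chosen lift of each generator of
    -- `Φ`.
    compact⇒preimage-compact : IsCompact A (ker q) → IsCompact B Φ → IsCompact A (preimage q Φ)
    compact⇒preimage-compact ker-compact (ps , Φ⊆ps , ps⊆Φ) =
      compact-resp Ψ (preimage q Φ)
        ( Cg-least A (preimage q Φ) Ψ⊆
        , λ p → tran (unlift _) (tran (lift-preserves (Φ⊆ps p)) (symm (unlift _))))
        (adjoin-compact (ker q) lifted ker-compact)
      where
      lift² : B.Carrier × B.Carrier → Carrier A × Carrier A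
      lift² (b , b′) = lift b , lift b′

      lifted = map lift² ps
      Ψ = adjoin (ker q) lifted

      Ψ⊆ : Congruence._∼_ (ker q) ∪ Pairs A lifted ⇒ Congruence._∼_ (preimage q Φ)
      Ψ⊆ (inj₁ p) = Φ.respects-≈ p
      Ψ⊆ (inj₂ m) with ∈-map⁻ lift² m
      ... | _ , m′ , ≡.refl = E.trans q∘lift∼ (E.trans (ps⊆Φ (gen m′)) (E.sym q∘lift∼))

      unlift : ∀ a → Congruence._∼_ Ψ a (lift (⟦ q ⟧ a))
      unlift a = gen (inj₁ (B.sym (q∘lift _)))

      -- The section `lift` respects equality and operations only modulo `ker q`; as `Ψ` contains
      -- `ker q`, pulling `Ψ` back along `lift` still gives a congruence.
      pulled : Congruence B
      pulled = record
        { _∼_           = λ b b′ → Congruence._∼_ Ψ (lift b) (lift b′)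
        ; isEquivalence = record { refl = equal (Algebra.refl A) ; sym = symm ; trans = tran }
        ; respects-≈    = λ p → gen (inj₁ (B.trans (q∘lift _) (B.trans p (B.sym (q∘lift _)))))
        ; compatible    = λ f rs →
            tran (gen (inj₁ (lift-op f _))) (tran (comp f rs) (symm (gen (inj₁ (lift-op f _)))))
        }
        where
        lift-op : ∀ f bs → ⟦ q ⟧ (lift (B.op f bs)) B.≈ ⟦ q ⟧ (Algebra.op A f (lift ∘ bs))
        lift-op f bs = B.trans (q∘lift _)
          (B.sym (B.trans (Hom.homo q f _) (B.op-cong f (λ i → q∘lift (bs i)))))

      lift-preserves : ∀ {b b′} → Generated B (Pairs B ps) b b′ → Congruence._∼_ Ψ (lift b) (lift b′)
      lift-preserves = Cg-least B pulled (λ m → gen (inj₂ (∈-map⁺ lift² m)))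

-- Finite presentations

-- An exhaustive list, so that `Fin m ⊎ Fin n` qualifies without being re-indexed.
Finite : Set → Set
Finite X = ∃[ xs ] ((x : X) → x ∈ xs)

Fin-finite : (n : ℕ) → Finite (Fin n)
Fin-finite n = allFin n , ∈-allFin

⊎-finite : {X Y : Set} → Finite X → Finite Y → Finite (X ⊎ Y)
⊎-finite (xs , ∈xs) (ys , ∈ys) = map inj₁ xs ++ map inj₂ ys ,
  λ { (inj₁ x) → ∈-++⁺ˡ (∈-map⁺ inj₁ (∈xs x))
    ; (inj₂ y) → ∈-++⁺ʳ (map inj₁ xs) (∈-map⁺ inj₂ (∈ys y)) }

-- α⁻¹Φ is generated by the image of Φ under β and the pairs (x , β (α x)).
preimage-compact-section : Finite X → (α : Hom (F V X) B) (β : Hom B (F V X)) (Φ : Congruence B) →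
  (∀ b → Congruence._∼_ Φ (⟦ α ⟧ (⟦ β ⟧ b)) b) →
  IsCompact B Φ → IsCompact (F V X) (preimage α Φ)
preimage-compact-section {X = X} {V = V} {B = B} (xs , ∈xs) α β Φ αβ Φ-compact =
  compact-resp Ψ (preimage α Φ)
    ( Cg-least (F V X) (preimage α Φ) Ψ⊆
    , λ p → tran (retract _) (tran (gen (inj₁ (gen (image p)))) (symm (retract _))))
    (adjoin-compact (lifting β Φ) pairs (lifting-compact β {Φ} Φ-compact))
  where
  module Φ = Congruence Φ
  module E = IsEquivalence Φ.isEquivalence

  pair : X → Term _ X × Term _ X
  pair x = var x , ⟦ β ⟧ (⟦ α ⟧ (var x))

  pairs = map pair xs
  Ψ = adjoin (lifting β Φ) pairs

  Ψ⊆ : Congruence._∼_ (lifting β Φ) ∪ Pairs (F V X) pairs ⇒ Congruence._∼_ (preimage α Φ)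
  Ψ⊆ (inj₁ p) = lifting-least β Φ (preimage α Φ)
    (λ r → E.trans (αβ _) (E.trans r (E.sym (αβ _)))) p
  Ψ⊆ (inj₂ m) with ∈-map⁻ pair m
  ... | _ , _ , ≡.refl = E.sym (αβ _)

  -- Modulo `Ψ`, the identity and β ∘ α are homomorphisms that agree on the variables, by the
  -- adjoined pairs.
  retract : ∀ t → Congruence._∼_ Ψ t (⟦ β ⟧ (⟦ α ⟧ t))
  retract = extend-unique {V = V} (quotientMap Ψ) (quotientMap Ψ ∘ₕ β ∘ₕ α)
    (λ x → gen (inj₂ (∈-map⁺ pair (∈xs x))))

-- A surjection with compact kernel replaces the isomorphism with a quotient, since surjections are
-- easier to compose and to lift against.
Presentation : Variety 𝓛 → Set → Algebra 𝓛 → Set _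
Presentation V X A = Σ (Hom (F V X) A) λ q → IsSurjective q × IsCompact (F V X) (ker q)

presentation : FinitelyPresented V A → ∃[ n ] Presentation V (Fin n) A
presentation {V = V} (n , Θ , Θ-compact , h , iso) = n , q , inverse-surjective h iso ,
  compact-resp Θ (ker q)
    (Hom.cong (inverse h iso) , inverse-injective h iso) Θ-compact
  where
  q = inverse h iso ∘ₕ quotientMap Θ

finitelyPresented : (n : ℕ) → Presentation V (Fin n) A → FinitelyPresented V A
finitelyPresented {A = A} n (q , surj , c) = n , ker q , c , ≅-inverse q/ker
  (id , λ a → proj₁ (surj a) , λ p → Algebra.trans A p (proj₂ (surj a)))
  where
  q/ker : Hom (F _ (Fin n) / ker q) A
  q/ker = record { ⟦_⟧ = ⟦ q ⟧ ; cong = id ; homo = Hom.homo q }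

module _ {q : Hom A B} (surj : IsSurjective q) (A∈V : A ∈ᵥ V) (g : Hom (F V X) B) where

  -- Projectivity of free algebras: `g` factors through the surjection `q`.
  freeLift : Hom (F V X) A
  freeLift = extend A∈V (λ x → proj₁ (surj (⟦ g ⟧ (var x))))

  freeLift-correct : ∀ t → Algebra._≈_ B (⟦ q ⟧ (⟦ freeLift ⟧ t)) (⟦ g ⟧ t)
  freeLift-correct = extend-unique {V = V} (q ∘ₕ freeLift) g (λ x → proj₂ (surj (⟦ g ⟧ (var x))))

-- Compactness of the kernel does not depend on the presentation. Lifting `q` through `p` gives α
-- with ker q = α⁻¹(ker p), and lifting `p` through `q` gives β, a section of α modulo `ker p`.
ker-compact : Finite X → (q : Hom (F V X) A) → IsSurjective q →
              {Y : Set} → Presentation V Y A → IsCompact (F V X) (ker q)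
ker-compact {X = X} {V = V} {A = A} fin q q-surj {Y} (p , p-surj , p-compact) =
  compact-resp (preimage α (ker p)) (ker q)
    ( (λ r → A.trans (A.sym (pα _)) (A.trans r (pα _)))
    , (λ r → A.trans (pα _) (A.trans r (A.sym (pα _)))))
    (preimage-compact-section {V = V} fin α β (ker p) (λ b → A.trans (pα _) (qβ b)) p-compact)
  where
  module A = Algebra A
  α = freeLift {V = V} {q = p} p-surj (F∈V V Y) q
  β = freeLift {V = V} {q = q} q-surj (F∈V V X) p
  pα = freeLift-correct {V = V} {q = p} p-surj (F∈V V Y) q
  qβ = freeLift-correct {V = V} {q = q} q-surj (F∈V V X) p

free-presentation : (X : Set) → Presentation V X (F V X)
free-presentation {V = V} X =
  idHom , (λ t → t , Algebra.refl (F V X)) , identity-compact (F V X)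

-- Presentations are indexed by a single `Fin`, so the variables are renumbered; `join` gives a
-- section of the renaming by `splitAt`, which makes its kernel compact.
F-⊎-finitelyPresented : (V : Variety 𝓛) (m n : ℕ) → FinitelyPresented V (F V (Fin m ⊎ Fin n))
F-⊎-finitelyPresented V m n = finitelyPresented {V = V} (m + n)
  (α , (λ t → ⟦ β ⟧ t , αβ t) ,
   preimage-compact-section {V = V} (Fin-finite (m + n)) α β
     (identity FX) αβ (identity-compact FX))
  where
  FX = F V (Fin m ⊎ Fin n)

  α : Hom (F V (Fin (m + n))) FX
  α = extend (F∈V V _) (var ∘ splitAt m)

  β : Hom FX (F V (Fin (m + n)))
  β = extend (F∈V V _) (var ∘ join m n)

  αβ : ∀ t → Algebra._≈_ FX (⟦ α ⟧ (⟦ β ⟧ t)) t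
  αβ = extend-unique {V = V} (α ∘ₕ β) idHom
    (λ x → equal (var-cong (splitAt-join m n x)))

-- The equivalences

-- The quotient of `F V X` by the congruence generated by `Γ` is a generic model of `Γ`. Conversely,
-- the kernel of any model's evaluation map contains `Γ`, hence that congruence.
⊨⇔Generated : (V : Variety 𝓛) {X : Set} (Γ : List (Equation 𝓛 X)) (s t : Term 𝓛 X) →
              (Γ ⊨[ V ] (s , t)) ⇔ Generated (F V X) (Pairs (F V X) Γ) s t
⊨⇔Generated {𝓛 = 𝓛} V {X} Γ s t = mk⇔ complete sound
  where
  Θ = Cg (F V X) (Pairs (F V X) Γ)

  complete : Γ ⊨[ V ] (s , t) → Generated (F V X) (Pairs (F V X) Γ) s t
  complete Γ⊨ = Γ⊨ (F V X / Θ) (F/∈V {V = V} Θ)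
    (quotientMap Θ ∘ₕ quotientMap (Cg (TermAlgebra 𝓛 X) (Instance V)))
    (All.tabulate gen)

  sound : Generated (F V X) (Pairs (F V X) Γ) s t → Γ ⊨[ V ] (s , t)
  sound p A A∈V e Γ-holds = A.trans (agree s) (A.trans
    (Cg-least (F V X) (ker e′)
      (λ m → A.trans (A.sym (agree _)) (A.trans (All.lookup Γ-holds m) (agree _))) p)
    (A.sym (agree t)))
    where
    module A = Algebra A
    e′ : Hom (F V X) A
    e′ = extend A∈V (⟦ e ⟧ ∘ var)

    agree : ∀ u → ⟦ e ⟧ u A.≈ ⟦ e′ ⟧ u
    agree = Hom-unique e (evalHom A (⟦ e ⟧ ∘ var)) (λ _ → A.refl)

-- Condition (2), as `Θ ∩F²` unfolds to the preimage under the inclusion.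
RestrictionCompact : Variety 𝓛 → Set _
RestrictionCompact V = (m n : ℕ) → PreimageCompact (inclusion V (Fin m) (Fin n))

module _ (V : Variety 𝓛) {X Y : Set} (Γ : List (Equation 𝓛 (X ⊎ Y))) where
  private
    Θ = Cg (F V (X ⊎ Y)) (Pairs (F V (X ⊎ Y)) Γ)

    rename-inclusion : ∀ t → Algebra._≈_ (F V (X ⊎ Y)) (rename inj₂ t) (⟦ inclusion V X Y ⟧ t)
    rename-inclusion = Hom-unique
      (quotientMap (Cg _ (Instance V)) ∘ₕ evalHom (TermAlgebra 𝓛 (X ⊎ Y)) (var ∘ inj₂))
      (evalHom (F V (X ⊎ Y)) (var ∘ inj₂))
      (λ _ → Algebra.refl (F V (X ⊎ Y)))

  ⊨-rename⇔ : (s t : Term 𝓛 Y) →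
    (Γ ⊨[ V ] renameEq inj₂ (s , t)) ⇔ Congruence._∼_ (preimage (inclusion V X Y) Θ) s t
  ⊨-rename⇔ s t = ⊨⇔Generated V Γ _ _ ⨾ mk⇔
    (λ p → tran (symm (equal (rename-inclusion s))) (tran p (equal (rename-inclusion t))))
    (λ p → tran (equal (rename-inclusion s)) (tran p (symm (equal (rename-inclusion t)))))

  -- An equation is a pair of elements of the free algebra, so the same list `Π` serves as
  -- interpolant and as generating set of the restricted congruence.
  interpolant⇔compact :
    (∃[ Π ] ((ε : Equation 𝓛 Y) → (Γ ⊨[ V ] renameEq inj₂ ε) ⇔ (Π ⊨[ V ] ε))) ⇔
    IsCompact (F V Y) (preimage (inclusion V X Y) Θ)
  interpolant⇔compact = mk⇔
    (λ (Π , eq) → Π ,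
      (λ {s} {t} → Equivalence.to   (⇔-sym (⊨-rename⇔ s t) ⨾ eq (s , t) ⨾ ⊨⇔Generated V Π s t)) ,
      (λ {s} {t} → Equivalence.from (⇔-sym (⊨-rename⇔ s t) ⨾ eq (s , t) ⨾ ⊨⇔Generated V Π s t)))
    (λ (Π , to , from) → Π , λ (s , t) →
      ⊨-rename⇔ s t ⨾ mk⇔ to from ⨾ ⇔-sym (⊨⇔Generated V Π s t))

-- From inclusions to all homomorphisms between finitely presented algebras.

module _ {V : Variety 𝓛} (rc : RestrictionCompact V) where

  -- k⁻¹Ψ is the restriction to F(Y) of r⁻¹Ψ, where r : F(X,Y) → F(X) is the
  -- identity on X and k on Y.
  free-preimageCompact : {m n : ℕ} (k : Hom (F V (Fin n)) (F V (Fin m))) → PreimageCompact k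
  free-preimageCompact {m} {n} k Ψ Ψ-compact =
    compact-resp (preimage (inclusion V (Fin m) (Fin n)) (preimage r Ψ)) (preimage k Ψ)
      ( (λ p → E.trans (E.sym (ri _)) (E.trans p (ri _)))
      , (λ p → E.trans (ri _) (E.trans p (E.sym (ri _)))))
      (rc m n (preimage r Ψ)
        -- The inclusion `j` of the first block of variables is a section of `r`, so r⁻¹Ψ is
        -- compact.
        (preimage-compact-section {V = V} (⊎-finite (Fin-finite m) (Fin-finite n)) r j Ψ
          (λ t → Ψ.respects-≈ (rj t)) Ψ-compact))
    where
    module Ψ = Congruence Ψ
    module E = IsEquivalence Ψ.isEquivalence

    r : Hom (F V (Fin m ⊎ Fin n)) (F V (Fin m))
    r = extend (F∈V V (Fin m)) [ var , ⟦ k ⟧ ∘ var ]′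

    j : Hom (F V (Fin m)) (F V (Fin m ⊎ Fin n))
    j = extend (F∈V V (Fin m ⊎ Fin n)) (var ∘ inj₁)

    rj : ∀ t → Algebra._≈_ (F V (Fin m)) (⟦ r ⟧ (⟦ j ⟧ t)) t
    rj = extend-unique {V = V} (r ∘ₕ j) idHom (λ _ → Algebra.refl (F V (Fin m)))

    ri : ∀ t → ⟦ r ⟧ (⟦ inclusion V (Fin m) (Fin n) ⟧ t) Ψ.∼ ⟦ k ⟧ t
    ri t = Ψ.respects-≈ (extend-unique {V = V} (r ∘ₕ inclusion V (Fin m) (Fin n)) k
      (λ _ → Algebra.refl (F V (Fin m))) t)

  -- Composing with the presentation `p`, `h` becomes q ∘ k for a map `k` of free algebras, so
  -- p⁻¹(h⁻¹Φ) = k⁻¹(q⁻¹Φ) is compact; the surjection `p` then reflects compactness.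
  preimageCompact : FinitelyPresented V A → FinitelyPresented V B → (h : Hom A B) → PreimageCompact h
  preimageCompact A-fp B-fp h Φ Φ-compact with presentation A-fp | presentation B-fp
  ... | n , p , p-surj , _ | m , q , q-surj , q-compact =
    preimage-compact⇒compact p p-surj (preimage h Φ)
      (compact-resp (preimage k (preimage q Φ)) (preimage (h ∘ₕ p) Φ)
        ( (λ r → E.trans (E.sym (qk _)) (E.trans r (qk _)))
        , (λ r → E.trans (qk _) (E.trans r (E.sym (qk _)))))
        (free-preimageCompact k (preimage q Φ)
          (compact⇒preimage-compact q q-surj Φ q-compact Φ-compact)))
    where
    module Φ = Congruence Φ
    module E = IsEquivalence Φ.isEquivalence
    k = freeLift {V = V} {q = q} q-surj (F∈V V (Fin m)) (h ∘ₕ p)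

    qk : ∀ t → ⟦ q ⟧ (⟦ k ⟧ t) Φ.∼ ⟦ h ⟧ (⟦ p ⟧ t)
    qk t = Φ.respects-≈ (freeLift-correct {V = V} {q = q} q-surj (F∈V V (Fin m)) (h ∘ₕ p) t)

F-finitelyPresented : (V : Variety 𝓛) (n : ℕ) → FinitelyPresented V (F V (Fin n))
F-finitelyPresented V n = finitelyPresented n (free-presentation (Fin n))

-- Finitely generated subalgebras and coherence.

corestrict : (h : Hom A B) (U : Subuniverse B) →
             (∀ a → Subuniverse.Member U (⟦ h ⟧ a)) → Hom A (subalgebra B U)
corestrict h U h∈U = record
  { ⟦_⟧ = λ a → ⟦ h ⟧ a , h∈U a ; cong = Hom.cong h ; homo = Hom.homo h }

range⊆ : (h : Hom (F V X) A) (U : Subuniverse A) →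
         (∀ x → Subuniverse.Member U (⟦ h ⟧ (var x))) → ∀ t → Subuniverse.Member U (⟦ h ⟧ t)
range⊆                 h U h∈U (var x)    = h∈U x
range⊆ {V = V} {A = A} h U h∈U (app f ts) =
  Subuniverse.resp U (Algebra.sym A (Hom.homo h f ts))
    (Subuniverse.closed U f (λ i → range⊆ {V = V} h U h∈U (ts i)))

Sg⊆range : (h : Hom A B) {S : Pred (Carrier B) _} (let open Algebra B) →
           (∀ {b} → S b → ∃[ a ] (⟦ h ⟧ a ≈ b)) → ∀ {b} → Sg B S b → ∃[ a ] (⟦ h ⟧ a ≈ b)
Sg⊆range             h S⊆ (generator m)  = S⊆ m
Sg⊆range {B = B}     h S⊆ (respects p u) =
  let a , r = Sg⊆range h S⊆ u in a , Algebra.trans B r p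
Sg⊆range {A = A} {B} h S⊆ (apply f us)   =
  Algebra.op A f (λ i → proj₁ (Sg⊆range h S⊆ (us i))) ,
  Algebra.trans B (Hom.homo h f _)
    (Algebra.op-cong B f (λ i → proj₂ (Sg⊆range h S⊆ (us i))))

restrictionCompact⇒coherent : (V : Variety 𝓛) → RestrictionCompact V → Coherent V
restrictionCompact⇒coherent {𝓛 = 𝓛} V rc A A∈V A-fp U (gs , U⊆gs , gs⊆U) =
  finitelyPresented n (q , surj ,
    -- Equality in the subalgebra is that of `A`, so `ker q` is the preimage of the identity
    -- congruence under `g`.
    preimageCompact rc (F-finitelyPresented V n) A-fp g (identity A) (identity-compact A))
  where
  module A = Algebra A
  n = length gs

  g : Hom (F V (Fin n)) A
  g = extend A∈V (lookup gs)

  q : Hom (F V (Fin n)) (subalgebra A U)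
  q = corestrict g U (range⊆ {V = V} g U (λ i → gs⊆U (generator (∈-lookup i))))

  gs⊆range : ∀ {a} → a ∈ gs → ∃[ t ] (⟦ g ⟧ t A.≈ a)
  gs⊆range m = var (index m) ,
    IsEquivalence.reflexive A.isEquivalence (≡.sym (lookup-index m))

  surj : IsSurjective q
  surj (a , a∈U) = Sg⊆range g gs⊆range (U⊆gs a∈U)

coherent⇒restrictionCompact : (V : Variety 𝓛) → Coherent V → RestrictionCompact V
coherent⇒restrictionCompact V coh m n Θ Θ-compact =
  -- Equality in the subalgebra `U` is `Θ`, so `ker q` unfolds to the preimage of `Θ` under `ι`.
  ker-compact {V = V} (Fin-finite n) q surj (proj₂ (presentation U-fp))
  where
  FX = F V (Fin m ⊎ Fin n)
  FX/Θ = FX / Θ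
  module Q = Algebra FX/Θ
  ι = inclusion V (Fin m) (Fin n)
  ys = map (var ∘ inj₂) (allFin n)

  U : Subuniverse FX/Θ
  U = record { Member = Sg FX/Θ (_∈ ys) ; resp = respects ; closed = apply }

  FX/Θ-fp : FinitelyPresented V FX/Θ
  -- The composite of a presentation `p` of `FX` with the quotient map has kernel p⁻¹Θ.
  FX/Θ-fp = let k , p , p-surj , p-compact = presentation {V = V} (F-⊎-finitelyPresented V m n) in
    finitelyPresented {V = V} k
      ( quotientMap Θ ∘ₕ p
      , (λ t → proj₁ (p-surj t) , Congruence.respects-≈ Θ (proj₂ (p-surj t)))
      , compact⇒preimage-compact p p-surj Θ p-compact Θ-compact)

  U-fp : FinitelyPresented V (subalgebra FX/Θ U)
  U-fp = coh FX/Θ (F/∈V {V = V} Θ) FX/Θ-fp U (ys , id , id)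

  q : Hom (F V (Fin n)) (subalgebra FX/Θ U)
  q = corestrict (quotientMap Θ ∘ₕ ι) U
    (range⊆ {V = V} (quotientMap Θ ∘ₕ ι) U (λ y → generator (∈-map⁺ (var ∘ inj₂) (∈-allFin y))))

  ys⊆range : ∀ {a} → a ∈ ys → ∃[ t ] (⟦ ι ⟧ t Q.≈ a)
  ys⊆range m with ∈-map⁻ (var ∘ inj₂) m
  ... | y , _ , ≡.refl = var y , Q.refl

  surj : IsSurjective q
  surj (a , a∈U) = Sg⊆range (quotientMap Θ ∘ₕ ι) ys⊆range a∈U

coherent⇔restrictionCompact : (V : Variety 𝓛) → Coherent V ⇔ RestrictionCompact V
coherent⇔restrictionCompact V =
  mk⇔ (coherent⇒restrictionCompact V) (restrictionCompact⇒coherent V)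

theorem2p3 : {ℓ : Level} (𝓛 : Signature ℓ) → HasConstant 𝓛 → (V : Variety 𝓛) →
    (Coherent V ⇔
    ((m n : ℕ) (Γ : List (Equation 𝓛 (Fin m ⊎ Fin n))) →
    ∃[ Π ] ((ε : Equation 𝓛 (Fin n)) → (Γ ⊨[ V ] renameEq inj₂ ε) ⇔ (Π ⊨[ V ] ε))))
    ×
    (Coherent V ⇔
    ((m n : ℕ) (Θ : Congruence (F V (Fin m ⊎ Fin n))) →
    IsCompact (F V (Fin m ⊎ Fin n)) Θ → IsCompact (F V (Fin n)) (Θ ∩F²)))
    ×
    (Coherent V ⇔
    ((m n : ℕ) → HasRightAdjoint (compactLifting (inclusion V (Fin m) (Fin n)))))
    ×
    (Coherent V ⇔
    ((A B : Algebra 𝓛) → A ∈ᵥ V → B ∈ᵥ V →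
    FinitelyPresented V A → FinitelyPresented V B →
    (h : Hom A B) → HasRightAdjoint (compactLifting h)))
theorem2p3 𝓛 _ V =
  coherent⇔RC ⨾ mk⇔
    (λ rc m n Γ → Equivalence.from (interpolant⇔compact V Γ)
      (rc m n (Cg (F₂ m n) (Pairs (F₂ m n) Γ)) (Cg-compact {A = F₂ m n} Γ)))
    -- The generators of `Θ`, read as equations, form the set to be interpolated.
    (λ interpolate m n Θ (Γ , Θ⊆Γ , Γ⊆Θ) → compact-resp
      (preimage (ι m n) (Cg (F₂ m n) (Pairs (F₂ m n) Γ))) (preimage (ι m n) Θ) (Γ⊆Θ , Θ⊆Γ)
      (Equivalence.to (interpolant⇔compact V Γ) (interpolate m n Γ))) ,
  coherent⇔RC ,
  coherent⇔RC ⨾ mk⇔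
    (λ rc m n → Equivalence.from (rightAdjoint⇔preimageCompact (ι m n)) (rc m n))
    (λ adj m n → Equivalence.to (rightAdjoint⇔preimageCompact (ι m n)) (adj m n)) ,
  coherent⇔RC ⨾ mk⇔
    (λ rc A B _ _ A-fp B-fp h →
      Equivalence.from (rightAdjoint⇔preimageCompact h) (preimageCompact rc A-fp B-fp h))
    -- The inclusion is itself a homomorphism between finitely presented algebras, so (4)
    -- specialises to (3).
    (λ adj m n → Equivalence.to (rightAdjoint⇔preimageCompact (ι m n))
      (adj (F V (Fin n)) (F₂ m n) (F∈V V _) (F∈V V _)
        (F-finitelyPresented V n) (F-⊎-finitelyPresented V m n) (ι m n)))
  where
  coherent⇔RC = coherent⇔restrictionCompact V

  F₂ : ℕ → ℕ → Algebra 𝓛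
  F₂ m n = F V (Fin m ⊎ Fin n)

  ι : ∀ m n → Hom (F V (Fin n)) (F₂ m n)
  ι m n = inclusion V (Fin m) (Fin n)
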